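{- For every finite simple gammoid $M$, $$\sum_{L \in \mathcal{L}(M)} (|L|-2) \leq |E(M)| - r(M),$$ where $\mathcal{L}(M)$ is the set of long lines of $M$, that is, the set of rank-two flats of $M$ with at least three elements.
   Context: All matroids and directed graphs are finite. $E(M)$ is the ground set and $r(M)$ the rank of a matroid $M$. A matroid is simple if it has no loops and no parallel pairs. A flat is a set equal to its own closure. Gammoids: let $D$ be a finite directed graph and let $T, E \subseteq V(D)$. A set $I \subseteq E$ is linkable to $T$ if there are pairwise vertex-disjoint directed paths in $D$ whose initial vertices are exactly the elements of $I$ and whose terminal vertices lie in $T$ (paths of length zero are allowed). The subsets of $E$ linkable to $T$ are the independent sets of a matroid on $E$; a matroid arising in this way is called a gammoid. -}

module Defs where

open import Level using (0ℓ)
open import Data.Bool.Properties as Bool using ()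
open import Data.Nat using (ℕ; zero; suc; _≤_; _<_; _≤?_)
open import Data.Nat.Properties as ℕ using ()
open import Data.Fin using (Fin)
open import Data.Fin.Properties as Fin using (any?)
open import Data.Fin.Subset using (Subset; inside; outside; _∈_; _∉_; _⊆_; _∪_; ⁅_⁆; ⊤; ⊥; ∣_∣)
open import Data.Fin.Subset.Properties using (_∈?_; _⊆?_)
open import Data.List using (List; []; _∷_; _++_; map; filter)
open import Data.List.Extrema.Nat using (max)
open import Data.List.Relation.Binary.Disjoint.Propositional using (Disjoint)
open import Data.List.Relation.Unary.Unique.Propositional using (Unique)
open import Data.Product using (Σ; ∃-syntax; _×_; proj₁)
open import Data.Vec using ([]; _∷_; tabulate)
open import Data.Vec.Properties using (≡-dec)
open import Function.Bundles using (_↣_; _⇔_; Injection)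
open import Relation.Binary using (Rel; Decidable)
open import Relation.Binary.Construct.Closure.ReflexiveTransitive using (Star; ε; _◅_)
open import Relation.Binary.PropositionalEquality using (_≡_; _≢_)
open import Relation.Nullary using (¬_; does; _×-dec_)
import Relation.Unary as Unary

allSubsets : ∀ n → List (Subset n)
allSubsets zero    = [] ∷ []
allSubsets (suc n) = map (outside ∷_) (allSubsets n) ++ map (inside ∷_) (allSubsets n)

image : ∀ {m n} → (Fin m → Fin n) → Subset m → Subset n
image f p = tabulate λ y → does (any? λ x → x ∈? p ×-dec f x Fin.≟ y)

-- A matroid whose ground set E(M) is Fin n.  Deciding independence is part of
-- the data, so that rank, closure and the set of long lines can be computed.
record Matroid (n : ℕ) : Set₁ where
  field
    Indep   : Subset n → Set
    indep?  : Unary.Decidable Indep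
    empty   : Indep ⊥
    hered   : ∀ {I J} → I ⊆ J → Indep J → Indep I
    augment : ∀ {I J} → Indep I → Indep J → ∣ I ∣ < ∣ J ∣ →
              ∃[ e ] e ∈ J × e ∉ I × Indep (I ∪ ⁅ e ⁆)

  rankOf : Subset n → ℕ
  rankOf X = max 0 (map ∣_∣ (filter (λ I → I ⊆? X ×-dec indep? I) (allSubsets n)))

  rank : ℕ
  rank = rankOf ⊤

  closure : Subset n → Subset n
  closure X = tabulate λ e → does (rankOf (X ∪ ⁅ e ⁆) ℕ.≟ rankOf X)

  Flat : Subset n → Set
  Flat X = closure X ≡ X

  flat? : Unary.Decidable Flat
  flat? X = ≡-dec Bool._≟_ (closure X) X

  Loop : Fin n → Set
  Loop e = ¬ Indep ⁅ e ⁆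

  Parallel : Fin n → Fin n → Set
  Parallel e f = e ≢ f × ¬ Loop e × ¬ Loop f × ¬ Indep (⁅ e ⁆ ∪ ⁅ f ⁆)

  Simple : Set
  Simple = (∀ e → ¬ Loop e) × (∀ e f → ¬ Parallel e f)

  LongLine : Subset n → Set
  LongLine L = Flat L × rankOf L ≡ 2 × 3 ≤ ∣ L ∣

  longLine? : Unary.Decidable LongLine
  longLine? L = flat? L ×-dec rankOf L ℕ.≟ 2 ×-dec 3 ≤? ∣ L ∣

  longLines : List (Subset n)
  longLines = filter longLine? (allSubsets n)

record Digraph (v : ℕ) : Set₁ where
  field
    Edge  : Rel (Fin v) 0ℓ
    edge? : Decidable Edge

  vertices : ∀ {x y} → Star Edge x y → List (Fin v)
  vertices {x} ε       = x ∷ []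
  vertices {x} (_ ◅ w) = x ∷ vertices w

  Path : Fin v → Fin v → Set
  Path x y = Σ (Star Edge x y) λ w → Unique (vertices w)

  -- The paths are indexed by their initial vertices, which loses nothing since
  -- disjoint paths have distinct initial vertices.
  record LinkableTo (T I : Subset v) : Set where
    field
      end      : ∀ {x} → x ∈ I → Fin v
      end∈T    : ∀ {x} (x∈I : x ∈ I) → end x∈I ∈ T
      path     : ∀ {x} (x∈I : x ∈ I) → Path x (end x∈I)
      disjoint : ∀ {x y} (x∈I : x ∈ I) (y∈I : y ∈ I) → x ≢ y →
                 Disjoint (vertices (proj₁ (path x∈I))) (vertices (proj₁ (path y∈I)))

-- The injection ι identifies the ground set Fin n with the subset E of V(D) = Fin v.
IsGammoid : ∀ {n} → Matroid n → Set₁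
IsGammoid {n} M =
  Σ ℕ λ v → Σ (Digraph v) λ D → Σ (Subset v) λ T → Σ (Fin n ↣ Fin v) λ ι →
  ∀ I → Matroid.Indep M I ⇔ Digraph.LinkableTo D T (image (Injection.to ι) I)

{-# OPTIONS --safe #-}
-- For a set X of vertices let ∂ X be the exits of X: its vertices that lie in T or have
-- an edge leaving X.  By Menger's theorem the rank of a set Y of elements is the least
-- ∣ ∂ X ∣ over the X containing Y, and ∣ ∂_ ∣ is submodular.  Every element e has a largest
-- set C e with a single exit, its gate; every long line L spans a largest set U with at
-- most two exits, and U contains the gates of the elements of L.  The spans of two lines
-- meet in a set with at most one exit, so a gate is a non-exit of at most one span.
-- Start from the union of the sets C e, whose exits are among the n gates, and add the
-- spans one by one: adding U turns the gates interior to U into non-exits and creates at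
-- most 2 - ∣ gates in ∂ U ∣ new exits, a net loss of at least ∣ L ∣ - 2.  What is left at
-- the end are at least r(M) exits, since the final set contains all elements.
module Submission where

open import Defs
open import Data.Empty using (⊥-elim)
open import Data.Fin using (Fin; zero; suc; _≟_)
open import Data.Fin.Properties using (any?; suc-injective)
open import Data.Fin.Subset
  using (Subset; inside; outside; _∈_; _∉_; _⊆_; _∪_; _∩_; _─_; _-_; ∁; ⁅_⁆; ⊤; ⊥; ∣_∣; Nonempty)
open import Data.Fin.Subset.Properties
open import Data.List using (List; []; _∷_; map; filter)
open import Data.List.Extrema.Nat using (max≤v⁺; v≤max⁺)
open import Data.List.Membership.Propositional using () renaming (_∈_ to _∈ˡ_)
open import Data.List.Membership.Propositional.Properties
  using (∈-map⁺; ∈-map⁻; ∈-++⁺ˡ; ∈-++⁺ʳ; ∈-filter⁺; ∈-filter⁻)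
open import Data.List.Relation.Binary.Disjoint.Propositional using (Disjoint)
open import Data.List.Relation.Unary.All as All using (All; []; _∷_)
import Data.List.Relation.Unary.All.Properties as All
open import Data.List.Relation.Unary.AllPairs using ([]; _∷_)
open import Data.List.Relation.Unary.Any as Any using (here; there)
open import Data.List.Relation.Unary.Unique.Propositional using (Unique)
import Data.List.Relation.Unary.Unique.Propositional.Properties as Unique
open import Data.Nat using (ℕ; zero; suc; _≤_; _<_; _+_; _∸_; _≤?_; z≤n; s≤s; s≤s⁻¹)
open import Data.Nat.Induction using (<-wellFounded)
open import Data.Nat.ListAction using (sum)
open import Data.Nat.Properties as ℕ
  using (≤-reflexive; ≤-trans; ≤-antisym; <⇒≱; ≰⇒>; n≤1+n; m≤m+n; m+n∸n≡m; +-suc; +-comm; +-assoc;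
         +-mono-≤; +-monoˡ-≤; +-monoʳ-≤; +-cancelˡ-≤; +-cancelʳ-≤; +-∸-assoc; ∸-monoˡ-≤;
         module ≤-Reasoning)
open import Algebra.Properties.CommutativeSemigroup ℕ.+-commutativeSemigroup using (interchange)
open import Data.Product using (∃; Σ-syntax; _×_; _,_; proj₁; proj₂)
open import Data.Sum using (_⊎_; inj₁; inj₂; [_,_]′)
open import Data.Vec using ([]; _∷_; here; there; tabulate)
open import Data.Vec.Properties using (lookup∘tabulate; []=⇒lookup; lookup⇒[]=; ∷-injectiveʳ)
open import Function using (_∘_; id; case_of_)
open import Function.Bundles using (_↣_; _⇔_; module Injection; module Equivalence)
open import Induction.WellFounded using (Acc; acc)
open import Level using (0ℓ)
open import Relation.Binary.Construct.Closure.ReflexiveTransitive using (Star; ε; _◅_)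
open import Relation.Binary.PropositionalEquality
  using (_≡_; _≢_; refl; sym; trans; cong; cong₂; subst)
open import Relation.Nullary using (¬_; Dec; yes; no; does; contradiction; _×-dec_; _⊎-dec_; ¬?)
open import Relation.Nullary.Decidable using (dec-true; decidable-stable)
open import Relation.Unary using (Pred; Decidable)

private variable
  m n v : ℕ

-- Finite sets: comprehension, cardinality, images

private
  witness : ∀ {A : Set} (a? : Dec A) → does a? ≡ inside → A
  witness (yes a) _ = a

module _ {P : Pred (Fin n) 0ℓ} (P? : Decidable P) where

  -- `image` and `closure` unfold to this same `tabulate`, so the two lemmas below also describe
  -- membership in them.
  comprehension : Subset n
  comprehension = tabulate (does ∘ P?)

  ∈-comprehension⁺ : ∀ {x} → P x → x ∈ comprehension
  ∈-comprehension⁺ {x} px =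
    lookup⇒[]= x _ (trans (lookup∘tabulate (does ∘ P?) x) (dec-true (P? x) px))

  ∈-comprehension⁻ : ∀ {x} → x ∈ comprehension → P x
  ∈-comprehension⁻ {x} x∈ =
    witness (P? x) (trans (sym (lookup∘tabulate (does ∘ P?) x)) ([]=⇒lookup x∈))

x∈p─q⇒x∉q : ∀ (p q : Subset n) {x} → x ∈ p ─ q → x ∉ q
x∈p─q⇒x∉q (_ ∷ p) (inside  ∷ q) (there x∈) (there x∈q) = x∈p─q⇒x∉q p q x∈ x∈q
x∈p─q⇒x∉q (_ ∷ p) (outside ∷ q) (there x∈) (there x∈q) = x∈p─q⇒x∉q p q x∈ x∈q

∪-lub : ∀ {p q r : Subset n} → p ⊆ r → q ⊆ r → p ∪ q ⊆ r
∪-lub {p = p} {q} p⊆r q⊆r = [ p⊆r , q⊆r ]′ ∘ x∈p∪q⁻ p q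

∣p∪q∣+∣p∩q∣≡∣p∣+∣q∣ : ∀ (p q : Subset n) → ∣ p ∪ q ∣ + ∣ p ∩ q ∣ ≡ ∣ p ∣ + ∣ q ∣
∣p∪q∣+∣p∩q∣≡∣p∣+∣q∣ []            []            = refl
∣p∪q∣+∣p∩q∣≡∣p∣+∣q∣ (inside  ∷ p) (inside  ∷ q) =
  cong suc (trans (+-suc _ _) (trans (cong suc (∣p∪q∣+∣p∩q∣≡∣p∣+∣q∣ p q)) (sym (+-suc _ _))))
∣p∪q∣+∣p∩q∣≡∣p∣+∣q∣ (inside  ∷ p) (outside ∷ q) = cong suc (∣p∪q∣+∣p∩q∣≡∣p∣+∣q∣ p q)
∣p∪q∣+∣p∩q∣≡∣p∣+∣q∣ (outside ∷ p) (inside  ∷ q) =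
  trans (cong suc (∣p∪q∣+∣p∩q∣≡∣p∣+∣q∣ p q)) (sym (+-suc _ _))
∣p∪q∣+∣p∩q∣≡∣p∣+∣q∣ (outside ∷ p) (outside ∷ q) = ∣p∪q∣+∣p∩q∣≡∣p∣+∣q∣ p q

∣p∪q∣≤∣p∣+∣q∣ : ∀ (p q : Subset n) → ∣ p ∪ q ∣ ≤ ∣ p ∣ + ∣ q ∣
∣p∪q∣≤∣p∣+∣q∣ p q = ≤-trans (m≤m+n _ _) (≤-reflexive (∣p∪q∣+∣p∩q∣≡∣p∣+∣q∣ p q))

∣p∣≡∣p∩q∣+∣p─q∣ : ∀ (p q : Subset n) → ∣ p ∣ ≡ ∣ p ∩ q ∣ + ∣ p ─ q ∣
∣p∣≡∣p∩q∣+∣p─q∣ []            []            = refl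
∣p∣≡∣p∩q∣+∣p─q∣ (inside  ∷ p) (inside  ∷ q) = cong suc (∣p∣≡∣p∩q∣+∣p─q∣ p q)
∣p∣≡∣p∩q∣+∣p─q∣ (inside  ∷ p) (outside ∷ q) =
  trans (cong suc (∣p∣≡∣p∩q∣+∣p─q∣ p q)) (sym (+-suc _ _))
∣p∣≡∣p∩q∣+∣p─q∣ (outside ∷ p) (inside  ∷ q) = ∣p∣≡∣p∩q∣+∣p─q∣ p q
∣p∣≡∣p∩q∣+∣p─q∣ (outside ∷ p) (outside ∷ q) = ∣p∣≡∣p∩q∣+∣p─q∣ p q

-- Cardinality is modular, so comparing unions and intersections suffices. This turns pointwise
-- facts about exits into submodularity.
∣p∣+∣q∣-mono : ∀ {p q r s : Subset n} → p ∪ q ⊆ r ∪ s → p ∩ q ⊆ r ∩ s →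
               ∣ p ∣ + ∣ q ∣ ≤ ∣ r ∣ + ∣ s ∣
∣p∣+∣q∣-mono {p = p} {q} {r} {s} ∪⊆ ∩⊆ = begin
  ∣ p ∣ + ∣ q ∣          ≡⟨ ∣p∪q∣+∣p∩q∣≡∣p∣+∣q∣ p q ⟨
  ∣ p ∪ q ∣ + ∣ p ∩ q ∣  ≤⟨ +-mono-≤ (p⊆q⇒∣p∣≤∣q∣ ∪⊆) (p⊆q⇒∣p∣≤∣q∣ ∩⊆) ⟩
  ∣ r ∪ s ∣ + ∣ r ∩ s ∣  ≡⟨ ∣p∪q∣+∣p∩q∣≡∣p∣+∣q∣ r s ⟩
  ∣ r ∣ + ∣ s ∣          ∎
  where open ≤-Reasoning

∣p∣≤1+∣p-x∣ : ∀ (p : Subset n) x → ∣ p ∣ ≤ suc ∣ p - x ∣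
∣p∣≤1+∣p-x∣ p x = begin
  ∣ p ∣                          ≡⟨ ∣p∣≡∣p∩q∣+∣p─q∣ p ⁅ x ⁆ ⟩
  ∣ p ∩ ⁅ x ⁆ ∣ + ∣ p - x ∣      ≤⟨ +-monoˡ-≤ _ (∣p∩q∣≤∣q∣ p ⁅ x ⁆) ⟩
  ∣ ⁅ x ⁆ ∣ + ∣ p - x ∣          ≡⟨ cong (_+ ∣ p - x ∣) (∣⁅x⁆∣≡1 x) ⟩
  suc ∣ p - x ∣                  ∎
  where open ≤-Reasoning

∣p∪⁅x⁆∣≤1+∣p∣ : ∀ (p : Subset n) x → ∣ p ∪ ⁅ x ⁆ ∣ ≤ suc ∣ p ∣
∣p∪⁅x⁆∣≤1+∣p∣ p x = begin
  ∣ p ∪ ⁅ x ⁆ ∣      ≤⟨ ∣p∪q∣≤∣p∣+∣q∣ p ⁅ x ⁆ ⟩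
  ∣ p ∣ + ∣ ⁅ x ⁆ ∣  ≡⟨ cong (∣ p ∣ +_) (∣⁅x⁆∣≡1 x) ⟩
  ∣ p ∣ + 1          ≡⟨ +-comm ∣ p ∣ 1 ⟩
  suc ∣ p ∣          ∎
  where open ≤-Reasoning

x∈p⇒1≤∣p∣ : ∀ {p : Subset n} {x} → x ∈ p → 1 ≤ ∣ p ∣
x∈p⇒1≤∣p∣ x∈p = ≤-trans (s≤s z≤n) (x∈p⇒∣p-x∣<∣p∣ x∈p)

x≢y⇒2≤∣p∣ : ∀ {p : Subset n} {x y} → x ∈ p → y ∈ p → x ≢ y → 2 ≤ ∣ p ∣
x≢y⇒2≤∣p∣ x∈p y∈p x≢y =
  ≤-trans (s≤s (x∈p⇒1≤∣p∣ (x∈p∧x≢y⇒x∈p-y x∈p x≢y))) (x∈p⇒∣p-x∣<∣p∣ y∈p)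

1≤∣p∣⇒Nonempty : ∀ {p : Subset n} → 1 ≤ ∣ p ∣ → Nonempty p
1≤∣p∣⇒Nonempty {n} {p} 1≤∣p∣ with nonempty? p
... | yes x∈p = x∈p
... | no  p-empty =
  contradiction 1≤∣p∣ (<⇒≱ (s≤s (≤-reflexive (trans (cong ∣_∣ (Empty-unique p-empty)) (∣⊥∣≡0 n)))))

-- The map takes the membership proof because the vertex where a path crosses a cut is chosen from
-- it.
injection⇒∣p∣≤∣q∣ : ∀ {p : Subset m} {q : Subset n} (g : ∀ {x} → x ∈ p → Fin n) →
  (∀ {x} (x∈p : x ∈ p) → g x∈p ∈ q) →
  (∀ {x y} (x∈p : x ∈ p) (y∈p : y ∈ p) → g x∈p ≡ g y∈p → x ≡ y) → ∣ p ∣ ≤ ∣ q ∣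
injection⇒∣p∣≤∣q∣ {p = []}          g g∈q inj = z≤n
injection⇒∣p∣≤∣q∣ {p = outside ∷ p} g g∈q inj =
  injection⇒∣p∣≤∣q∣ (g ∘ there) (g∈q ∘ there) λ x∈p y∈p → suc-injective ∘ inj (there x∈p) (there y∈p)
injection⇒∣p∣≤∣q∣ {p = inside ∷ p} {q} g g∈q inj = ≤-trans (s≤s ∣p∣≤) (x∈p⇒∣p-x∣<∣p∣ (g∈q here))
  where
  ∣p∣≤ : ∣ p ∣ ≤ ∣ q - g here ∣
  ∣p∣≤ = injection⇒∣p∣≤∣q∣ (g ∘ there)
    (λ x∈p → x∈p∧x≢y⇒x∈p-y (g∈q (there x∈p)) λ eq → case inj (there x∈p) here eq of λ ())
    λ x∈p y∈p → suc-injective ∘ inj (there x∈p) (there y∈p)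

module _ (f : Fin m → Fin n) where

  private
    hit? : ∀ p y → Dec (∃ λ x → x ∈ p × f x ≡ y)
    hit? p y = any? λ x → x ∈? p ×-dec f x ≟ y

  ∈-image⁺ : ∀ {p x} → x ∈ p → f x ∈ image f p
  ∈-image⁺ {p} {x} x∈p = ∈-comprehension⁺ (hit? p) (x , x∈p , refl)

  ∈-image⁻ : ∀ {p y} → y ∈ image f p → ∃ λ x → x ∈ p × f x ≡ y
  ∈-image⁻ {p} = ∈-comprehension⁻ (hit? p)

  image-⊆ : ∀ {p q} → (∀ {x} → x ∈ p → f x ∈ q) → image f p ⊆ q
  image-⊆ {q = q} f∈q y∈ with ∈-image⁻ y∈
  ... | x , x∈p , fx≡y = subst (_∈ q) fx≡y (f∈q x∈p)

  ∣image∣≤ : ∀ p → ∣ image f p ∣ ≤ ∣ p ∣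
  ∣image∣≤ p = injection⇒∣p∣≤∣q∣ (proj₁ ∘ ∈-image⁻) (proj₁ ∘ proj₂ ∘ ∈-image⁻)
    λ y∈ z∈ eq → trans (sym (proj₂ (proj₂ (∈-image⁻ y∈))))
                       (trans (cong f eq) (proj₂ (proj₂ (∈-image⁻ z∈))))

  ∣∣≤∣image∣ : (∀ {x y} → f x ≡ f y → x ≡ y) → ∀ p → ∣ p ∣ ≤ ∣ image f p ∣
  ∣∣≤∣image∣ inj p = injection⇒∣p∣≤∣q∣ (λ {x} _ → f x) ∈-image⁺ λ _ _ → inj

-- Enumeration of all subsets

∈-allSubsets : ∀ (p : Subset n) → p ∈ˡ allSubsets n
∈-allSubsets []            = here refl
∈-allSubsets (outside ∷ p) = ∈-++⁺ˡ (∈-map⁺ (outside ∷_) (∈-allSubsets p))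
∈-allSubsets (inside  ∷ p) = ∈-++⁺ʳ _ (∈-map⁺ (inside ∷_) (∈-allSubsets p))

-- Makes the entries of `longLines` pairwise distinct, as `gate-interior-once` demands.
allSubsets-unique : ∀ n → Unique (allSubsets n)
allSubsets-unique zero    = [] ∷ []
allSubsets-unique (suc n) =
  Unique.++⁺ (Unique.map⁺ ∷-injectiveʳ (allSubsets-unique n))
             (Unique.map⁺ ∷-injectiveʳ (allSubsets-unique n))
             λ (p∈ , q∈) → case trans (sym (proj₂ (proj₂ (∈-map⁻ _ p∈)))) (proj₂ (proj₂ (∈-map⁻ _ q∈)))
                           of λ ()

-- Submodular functions and their largest minimisers

module Submodular (f : Subset v → ℕ) (sub : ∀ X Y → f (X ∪ Y) + f (X ∩ Y) ≤ f X + f Y) where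

  ∪-tight : ∀ {j k l X Y} → f X ≤ j → f Y ≤ k → l ≤ f (X ∩ Y) → f (X ∪ Y) + l ≤ j + k
  ∪-tight {X = X} {Y} fX≤j fY≤k l≤ = ≤-trans (+-monoʳ-≤ _ l≤) (≤-trans (sub X Y) (+-mono-≤ fX≤j fY≤k))

  record Maximal (B : Subset v) (k : ℕ) (U : Subset v) : Set where
    field
      contains : B ⊆ U
      value≤   : f U ≤ k
      maximal  : ∀ {X} → B ⊆ X → f X ≤ k → X ⊆ U

  module _ {B : Subset v} {k : ℕ} (k≤ : ∀ {X} → B ⊆ X → k ≤ f X)
           {X₀ : Subset v} (B⊆X₀ : B ⊆ X₀) (fX₀≤k : f X₀ ≤ k) where

    private
      Absorbs : Subset v → Subset v → Set
      Absorbs U X = B ⊆ X × f X ≤ k → X ⊆ U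

      absorb : ∀ Xs → ∃ λ U → B ⊆ U × f U ≤ k × All (Absorbs U) Xs
      absorb []       = X₀ , B⊆X₀ , fX₀≤k , []
      absorb (X ∷ Xs) with absorb Xs | B ⊆? X ×-dec f X ≤? k
      ... | U , B⊆U , fU≤k , abs | no ¬tight =
        U , B⊆U , fU≤k , (λ tight → contradiction tight ¬tight) ∷ abs
      ... | U , B⊆U , fU≤k , abs | yes (B⊆X , fX≤k) =
        U ∪ X , p⊆p∪q X ∘ B⊆U ,
        -- The intersection still contains `B`, so its value is at least `k`, which leaves at most
        -- `k` for the union.
        +-cancelʳ-≤ k _ _ (∪-tight fU≤k fX≤k (k≤ λ b∈B → x∈p∩q⁺ (B⊆U b∈B , B⊆X b∈B))) ,
        (λ _ → q⊆p∪q U X) ∷ All.map (λ absY tight {_} y∈Y → p⊆p∪q X (absY tight y∈Y)) abs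

    -- Here `k` is the minimum of `f` over the sets containing `B`, attained at `X₀`. Minimisers of
    -- a submodular function are closed under union, so the union of all of them is again one.
    maximalSet : ∃ (Maximal B k)
    maximalSet with absorb (allSubsets v)
    ... | U , B⊆U , fU≤k , abs = U , record
      { contains = B⊆U
      ; value≤   = fU≤k
      ; maximal  = λ {X} B⊆X fX≤k → All.lookup abs (∈-allSubsets X) ((λ {_} → B⊆X) , fX≤k)
      }

-- Menger's theorem

module Cuts (D : Digraph v) (T : Subset v) where
  open Digraph D
  open LinkableTo

  -- The inner vertex boundary of `X` once a sink is attached to every vertex of `T`: a path may
  -- stop in `T`, which counts as leaving.
  Exit : Subset v → Fin v → Set
  Exit X x = x ∈ X × (x ∈ T ⊎ ∃ λ y → Edge x y × y ∉ X)

  exit? : ∀ X → Decidable (Exit X)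
  exit? X x = x ∈? X ×-dec (x ∈? T ⊎-dec any? λ y → edge? x y ×-dec ¬? (y ∈? X))

  ∂ : Subset v → Subset v
  ∂ X = comprehension (exit? X)

  ∂⁺ : ∀ {X x} → Exit X x → x ∈ ∂ X
  ∂⁺ {X} = ∈-comprehension⁺ (exit? X)

  ∂⁻ : ∀ {X x} → x ∈ ∂ X → Exit X x
  ∂⁻ {X} = ∈-comprehension⁻ (exit? X)

  ∂⊆ : ∀ {X} → ∂ X ⊆ X
  ∂⊆ = proj₁ ∘ ∂⁻

  -- An edge that leaves the larger set also leaves the smaller one.
  ∂-restrict : ∀ {X Y x} → X ⊆ Y → x ∈ X → x ∈ ∂ Y → x ∈ ∂ X
  ∂-restrict X⊆Y x∈X x∈∂Y with ∂⁻ x∈∂Y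
  ... | _ , inj₁ x∈T             = ∂⁺ (x∈X , inj₁ x∈T)
  ... | _ , inj₂ (y , xy , y∉Y) = ∂⁺ (x∈X , inj₂ (y , xy , y∉Y ∘ X⊆Y))

  ∂-∪ : ∀ X Y {x} → x ∈ ∂ (X ∪ Y) → x ∈ ∂ X ⊎ x ∈ ∂ Y
  ∂-∪ X Y x∈ with x∈p∪q⁻ X Y (∂⊆ x∈)
  ... | inj₁ x∈X = inj₁ (∂-restrict (p⊆p∪q Y) x∈X x∈)
  ... | inj₂ x∈Y = inj₂ (∂-restrict (q⊆p∪q X Y) x∈Y x∈)

  ∂-∩ : ∀ X Y {x} → x ∈ ∂ (X ∩ Y) → x ∈ ∂ X ⊎ x ∈ ∂ Y
  ∂-∩ X Y {x} x∈ with ∂⁻ x∈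
  ... | x∈X∩Y , inj₁ x∈T = inj₁ (∂⁺ (p∩q⊆p X Y x∈X∩Y , inj₁ x∈T))
  ... | x∈X∩Y , inj₂ (y , xy , y∉) with y ∈? X
  ...   | yes y∈X = inj₂ (∂⁺ (p∩q⊆q X Y x∈X∩Y , inj₂ (y , xy , λ y∈Y → y∉ (x∈p∩q⁺ (y∈X , y∈Y)))))
  ...   | no  y∉X = inj₁ (∂⁺ (p∩q⊆p X Y x∈X∩Y , inj₂ (y , xy , y∉X)))

  -- The deleted set `Z` is there for the induction in Menger's theorem; `⊥` in its place gives
  -- submodularity of `cut`.
  ∂-submodular : ∀ Z X Y → ∣ ∂ (X ∪ Y) ─ Z ∣ + ∣ ∂ (X ∩ Y) ─ Z ∣ ≤ ∣ ∂ X ─ Z ∣ + ∣ ∂ Y ─ Z ∣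
  ∂-submodular Z X Y = ∣p∣+∣q∣-mono
    (∪-lub (λ x∈ → spread (x∈p─q⇒x∉q _ Z x∈) (∂-∪ X Y (p─q⊆p _ Z x∈)))
           (λ x∈ → spread (x∈p─q⇒x∉q _ Z x∈) (∂-∩ X Y (p─q⊆p _ Z x∈))))
    -- A vertex counted twice on the left lies in both `X` and `Y`; being an exit of the union, it
    -- is an exit of each.
    λ x∈ → let x∈∪ , x∈∩ = x∈p∩q⁻ _ _ x∈
               x∈X∩Y     = ∂⊆ (p─q⊆p _ Z x∈∩)
               x∈∂∪      = p─q⊆p _ Z x∈∪
               x∉Z       = x∈p─q⇒x∉q _ Z x∈∪
           in x∈p∩q⁺ ( x∈p∧x∉q⇒x∈p─q (∂-restrict (p⊆p∪q Y) (p∩q⊆p X Y x∈X∩Y) x∈∂∪) x∉Z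
                     , x∈p∧x∉q⇒x∈p─q (∂-restrict (q⊆p∪q X Y) (p∩q⊆q X Y x∈X∩Y) x∈∂∪) x∉Z )
    where
    spread : ∀ {x} → x ∉ Z → x ∈ ∂ X ⊎ x ∈ ∂ Y → x ∈ (∂ X ─ Z) ∪ (∂ Y ─ Z)
    spread x∉Z (inj₁ x∈) = p⊆p∪q _ (x∈p∧x∉q⇒x∈p─q x∈ x∉Z)
    spread x∉Z (inj₂ x∈) = q⊆p∪q (∂ X ─ Z) _ (x∈p∧x∉q⇒x∈p─q x∈ x∉Z)

  -- The exit is the vertex from which the walk first leaves `X`, or its end in `T` if it never
  -- does.
  crossing : ∀ {X x t} (w : Star Edge x t) → x ∈ X → t ∈ T → ∃ λ z → z ∈ˡ vertices w × z ∈ ∂ X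
  crossing ε x∈X x∈T = _ , here refl , ∂⁺ (x∈X , inj₁ x∈T)
  crossing {X} (_◅_ {j = y} xy w) x∈X t∈T with y ∈? X
  ... | no  y∉X = _ , here refl , ∂⁺ (x∈X , inj₂ (y , xy , y∉X))
  ... | yes y∈X with crossing w y∈X t∈T
  ...   | z , z∈w , z∈∂ = z , there z∈w , z∈∂

  -- The easy half of Menger: disjoint paths meet `∂ X` in distinct vertices.
  linkable⇒≤cut : ∀ {A X} → LinkableTo T A → A ⊆ X → ∣ A ∣ ≤ ∣ ∂ X ∣
  linkable⇒≤cut {A} {X} link A⊆X =
    injection⇒∣p∣≤∣q∣ (proj₁ ∘ cross) (λ a∈A → proj₂ (proj₂ (cross a∈A))) λ {x} {y} x∈A y∈A eq →
      decidable-stable (x ≟ y) λ x≢y → disjoint link x∈A y∈A x≢y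
        (proj₁ (proj₂ (cross x∈A)) , subst (_∈ˡ _) (sym eq) (proj₁ (proj₂ (cross y∈A))))
    where
    cross : ∀ {a} (a∈A : a ∈ A) → ∃ λ z → z ∈ˡ vertices (proj₁ (path link a∈A)) × z ∈ ∂ X
    cross a∈A = crossing (proj₁ (path link a∈A)) (A⊆X a∈A) (end∈T link a∈A)

  record Avoiding (Z A : Subset v) : Set where
    field
      link   : LinkableTo T A
      avoids : ∀ {x z} (x∈A : x ∈ A) → z ∈ˡ vertices (proj₁ (path link x∈A)) → z ∉ Z

  stay : ∀ {Z A} → A ⊆ T → (∀ {x} → x ∈ A → x ∉ Z) → Avoiding Z A
  stay A⊆T A∩Z=∅ = record
    { link = record
      { end      = λ {x} _ → x
      ; end∈T    = A⊆T
      ; path     = λ _ → ε , [] ∷ []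
      ; disjoint = λ { _ _ x≢y (here refl , here refl) → x≢y refl }
      }
    ; avoids = λ { x∈A (here refl) → A∩Z=∅ x∈A }
    }

  -- The paths in `rest` avoid `a`, so prepending it to the path from `w` repeats no vertex and
  -- meets no other path. The condition on `w` keeps it apart from the other starting points.
  extend : ∀ {Z A a w} → Edge a w → w ∉ A - a → (∀ {x} → x ∈ A → x ∉ Z) →
           Avoiding (Z ∪ ⁅ a ⁆) ((A - a) ∪ ⁅ w ⁆) → Avoiding Z A
  extend {Z} {A} {a} {w} aw w∉ A∩Z=∅ rest = record
    { link = record
      { end      = λ x∈A → proj₁ (route x∈A)
      ; end∈T    = λ x∈A → proj₁ (proj₂ (route x∈A))
      ; path     = λ x∈A → proj₁ (proj₂ (proj₂ (route x∈A)))
      ; disjoint = apart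
      }
    ; avoids = λ x∈A → proj₂ (proj₂ (proj₂ (route x∈A)))
    }
    where
    open Avoiding rest renaming (link to link′; avoids to avoids′)

    w∈ : w ∈ (A - a) ∪ ⁅ w ⁆
    w∈ = q⊆p∪q (A - a) ⁅ w ⁆ (x∈⁅x⁆ w)

    kept : ∀ {x} → x ∈ A → x ≢ a → x ∈ (A - a) ∪ ⁅ w ⁆
    kept x∈A x≢a = p⊆p∪q ⁅ w ⁆ (x∈p∧x≢y⇒x∈p-y x∈A x≢a)

    a∉ : ∀ {x} (x∈ : x ∈ (A - a) ∪ ⁅ w ⁆) → ¬ a ∈ˡ vertices (proj₁ (path link′ x∈))
    a∉ x∈ a∈ = avoids′ x∈ a∈ (q⊆p∪q Z ⁅ a ⁆ (x∈⁅x⁆ a))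

    route : ∀ {x} → x ∈ A → ∃ λ t → t ∈ T × Σ[ p ∈ Path x t ] (∀ {z} → z ∈ˡ vertices (proj₁ p) → z ∉ Z)
    route {x} x∈A with x ≟ a
    ... | yes refl =
      end link′ w∈ , end∈T link′ w∈ ,
      (aw ◅ proj₁ (path link′ w∈) , All.¬Any⇒All¬ _ (a∉ w∈) ∷ proj₂ (path link′ w∈)) ,
      λ { (here refl) → A∩Z=∅ x∈A ; (there z∈) → avoids′ w∈ z∈ ∘ p⊆p∪q ⁅ a ⁆ }
    ... | no x≢a =
      end link′ (kept x∈A x≢a) , end∈T link′ (kept x∈A x≢a) , path link′ (kept x∈A x≢a) ,
      λ z∈ → avoids′ (kept x∈A x≢a) z∈ ∘ p⊆p∪q ⁅ a ⁆

    w≢ : ∀ {y} → y ∈ A → y ≢ a → w ≢ y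
    w≢ y∈A y≢a refl = w∉ (x∈p∧x≢y⇒x∈p-y y∈A y≢a)

    apart : ∀ {x y} (x∈A : x ∈ A) (y∈A : y ∈ A) → x ≢ y →
            Disjoint (vertices (proj₁ (proj₁ (proj₂ (proj₂ (route x∈A))))))
                     (vertices (proj₁ (proj₁ (proj₂ (proj₂ (route y∈A))))))
    apart {x} {y} x∈A y∈A x≢y with x ≟ a | y ≟ a
    ... | yes refl | yes refl = ⊥-elim (x≢y refl)
    ... | yes refl | no  y≢a  = λ
      { (here refl , z∈) → a∉ (kept y∈A y≢a) z∈
      ; (there z∈ , z∈′) → disjoint link′ w∈ (kept y∈A y≢a) (w≢ y∈A y≢a) (z∈ , z∈′) }
    ... | no  x≢a  | yes refl = λ
      { (z∈ , here refl) → a∉ (kept x∈A x≢a) z∈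
      ; (z∈ , there z∈′) → disjoint link′ w∈ (kept x∈A x≢a) (w≢ x∈A x≢a) (z∈′ , z∈) }
    ... | no  x≢a  | no  y≢a  = disjoint link′ (kept x∈A x≢a) (kept y∈A y≢a) x≢y

  -- One step of the induction: a is crossed off, and w, chosen outside the largest
  -- set that is tight for what remains, takes its place.
  module Advance {Z A a} (a∈A : a ∈ A) (a∉T : a ∉ T) (A∩Z=∅ : ∀ {x} → x ∈ A → x ∉ Z)
                 (cut≥ : ∀ {X} → A ∪ Z ⊆ X → ∣ A ∣ ≤ ∣ ∂ X ─ Z ∣) where

    private
      Z′ B : Subset v
      Z′ = Z ∪ ⁅ a ⁆
      B  = (A - a) ∪ Z′

      Z⊆Z′ : Z ⊆ Z′
      Z⊆Z′ = p⊆p∪q ⁅ a ⁆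

      a∈Z′ : a ∈ Z′
      a∈Z′ = q⊆p∪q Z ⁅ a ⁆ (x∈⁅x⁆ a)

      A⊆B : A ⊆ B
      A⊆B {x} x∈A with x ≟ a
      ... | yes refl = q⊆p∪q (A - a) Z′ a∈Z′
      ... | no  x≢a  = p⊆p∪q Z′ (x∈p∧x≢y⇒x∈p-y x∈A x≢a)

      A∪Z⊆B : A ∪ Z ⊆ B
      A∪Z⊆B = ∪-lub A⊆B (q⊆p∪q (A - a) Z′ ∘ Z⊆Z′)

      -- Deleting `a` costs at most one exit. With `upper`, this makes `∣ A - a ∣` the minimum over
      -- the sets containing `B`, as `maximalSet` requires.
      lower : ∀ {X} → B ⊆ X → ∣ A - a ∣ ≤ ∣ ∂ X ─ Z′ ∣
      lower {X} B⊆X = s≤s⁻¹ (begin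
        suc ∣ A - a ∣               ≤⟨ x∈p⇒∣p-x∣<∣p∣ a∈A ⟩
        ∣ A ∣                       ≤⟨ cut≥ (B⊆X ∘ A∪Z⊆B) ⟩
        ∣ ∂ X ─ Z ∣                 ≤⟨ ∣p∣≤1+∣p-x∣ (∂ X ─ Z) a ⟩
        suc ∣ ∂ X ─ Z ─ ⁅ a ⁆ ∣     ≡⟨ cong (suc ∘ ∣_∣) (p─q─r≡p─q∪r (∂ X) Z ⁅ a ⁆) ⟩
        suc ∣ ∂ X ─ Z′ ∣            ∎)
        where open ≤-Reasoning

      upper : ∣ ∂ B ─ Z′ ∣ ≤ ∣ A - a ∣
      upper = p⊆q⇒∣p∣≤∣q∣ λ x∈ →
        [ id , (λ x∈Z′ → ⊥-elim (x∈p─q⇒x∉q (∂ B) Z′ x∈ x∈Z′)) ]′ (x∈p∪q⁻ (A - a) Z′ (∂⊆ (p─q⊆p _ Z′ x∈)))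

      ∂─Z⊆∂─Z′ : ∀ {X} → a ∉ ∂ X → ∂ X ─ Z ⊆ ∂ X ─ Z′
      ∂─Z⊆∂─Z′ {X} a∉∂X x∈ = x∈p∧x∉q⇒x∈p─q (p─q⊆p (∂ X) Z x∈)
        ([ x∈p─q⇒x∉q (∂ X) Z x∈
         , (λ x∈a → a∉∂X (subst (_∈ ∂ X) (x∈⁅y⁆⇒x≡y a x∈a) (p─q⊆p (∂ X) Z x∈))) ]′ ∘ x∈p∪q⁻ Z ⁅ a ⁆)

    open Submodular (λ X → ∣ ∂ X ─ Z′ ∣) (∂-submodular Z′)
    open Maximal

    tight : ∃ (Maximal B ∣ A - a ∣)
    tight = maximalSet lower id upper

    module _ {U} (U-max : Maximal B ∣ A - a ∣ U) where

      -- Otherwise deleting `a` costs no exit, and `U` keeps at least `∣ A ∣` exits outside `Z′`,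
      -- more than tightness allows.
      a∈∂tight : a ∈ ∂ U
      a∈∂tight = decidable-stable (a ∈? ∂ U) λ a∉∂U → <⇒≱ (x∈p⇒∣p-x∣<∣p∣ a∈A)
        (≤-trans (cut≥ (contains U-max ∘ A∪Z⊆B))
          (≤-trans (p⊆q⇒∣p∣≤∣q∣ (∂─Z⊆∂─Z′ a∉∂U)) (value≤ U-max)))

      successor : ∃ λ w → Edge a w × w ∉ U
      successor = [ (λ a∈T → ⊥-elim (a∉T a∈T)) , id ]′ (proj₂ (∂⁻ a∈∂tight))

      module _ {w} (w∉U : w ∉ U) where

        w∉A-a : w ∉ A - a
        w∉A-a = w∉U ∘ contains U-max ∘ p⊆p∪q Z′

        advanced-avoids : ∀ {x} → x ∈ (A - a) ∪ ⁅ w ⁆ → x ∉ Z′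
        advanced-avoids x∈A′ x∈Z′ with x∈p∪q⁻ (A - a) ⁅ w ⁆ x∈A′ | x∈p∪q⁻ Z ⁅ a ⁆ x∈Z′
        ... | inj₁ x∈A-a | inj₁ x∈Z = A∩Z=∅ (p─q⊆p A ⁅ a ⁆ x∈A-a) x∈Z
        ... | inj₁ x∈A-a | inj₂ x∈a = x∈p─q⇒x∉q A ⁅ a ⁆ x∈A-a x∈a
        ... | inj₂ x∈w   | _        =
          w∉U (contains U-max (q⊆p∪q (A - a) Z′ (subst (_∈ Z′) (x∈⁅y⁆⇒x≡y w x∈w) x∈Z′)))

        -- A violating `X` would be tight for `B`, hence inside `U`, yet it contains `w`.
        advanced-cut≥ : ∀ {X} → ((A - a) ∪ ⁅ w ⁆) ∪ Z′ ⊆ X → ∣ (A - a) ∪ ⁅ w ⁆ ∣ ≤ ∣ ∂ X ─ Z′ ∣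
        advanced-cut≥ ⊆X = ≤-trans (∣p∪⁅x⁆∣≤1+∣p∣ (A - a) w) (≰⇒> λ fX≤ →
          w∉U (maximal U-max (∪-lub (⊆X ∘ p⊆p∪q Z′ ∘ p⊆p∪q ⁅ w ⁆) (⊆X ∘ q⊆p∪q ((A - a) ∪ ⁅ w ⁆) Z′)) fX≤
            (⊆X (p⊆p∪q Z′ (q⊆p∪q (A - a) ⁅ w ⁆ (x∈⁅x⁆ w))))))

    ∁-shrinks : ∣ ∁ Z′ ∣ < ∣ ∁ Z ∣
    ∁-shrinks = p⊂q⇒∣p∣<∣q∣ (p⊂q⇒∁p⊃∁q ((λ {_} → Z⊆Z′) , a , a∈Z′ , A∩Z=∅ a∈A))

  -- The hard half of Menger, generalised by a set `Z` of vertices already used by initial segments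
  -- of the paths. Each step adds a vertex to `Z`, so its complement is the measure.
  menger : ∀ Z A → Acc _<_ ∣ ∁ Z ∣ → (∀ {x} → x ∈ A → x ∉ Z) →
           (∀ {X} → A ∪ Z ⊆ X → ∣ A ∣ ≤ ∣ ∂ X ─ Z ∣) → Avoiding Z A
  menger Z A (acc rec) A∩Z=∅ cut≥ with any? (λ a → a ∈? A ×-dec ¬? (a ∈? T))
  ... | no ∄ = stay (λ {x} x∈A → decidable-stable (x ∈? T) λ x∉T → ∄ (x , x∈A , x∉T)) A∩Z=∅
  ... | yes (a , a∈A , a∉T) =
    let open Advance a∈A a∉T A∩Z=∅ cut≥
        U , U-max    = tight
        w , aw , w∉U = successor U-max
    in extend aw (w∉A-a U-max w∉U) A∩Z=∅
         (menger (Z ∪ ⁅ a ⁆) ((A - a) ∪ ⁅ w ⁆) (rec ∁-shrinks)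
           (advanced-avoids U-max w∉U) (advanced-cut≥ U-max w∉U))

  ≤cut⇒linkable : ∀ {A} → (∀ {X} → A ⊆ X → ∣ A ∣ ≤ ∣ ∂ X ∣) → LinkableTo T A
  ≤cut⇒linkable {A} cut≥ = Avoiding.link (menger ⊥ A (<-wellFounded _) (λ _ → ∉⊥)
    λ {X} A∪⊥⊆X → subst (∣ A ∣ ≤_) (cong ∣_∣ (sym (p─⊥≡p (∂ X)))) (cut≥ (A∪⊥⊆X ∘ p⊆p∪q ⊥)))

-- The matroid rank as a minimum cut

module Rank (M : Matroid n) where
  open Matroid M

  ∣indep∣≤rankOf : ∀ {I X} → I ⊆ X → Indep I → ∣ I ∣ ≤ rankOf X
  ∣indep∣≤rankOf {I} {X} I⊆X ind = v≤max⁺ 0 _ (inj₂ (Any.map ≤-reflexive (∈-map⁺ ∣_∣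
    (∈-filter⁺ (λ J → J ⊆? X ×-dec indep? J) (∈-allSubsets I) ((λ {_} → I⊆X) , ind)))))

  rankOf-least : ∀ {X k} → (∀ {I} → I ⊆ X → Indep I → ∣ I ∣ ≤ k) → rankOf X ≤ k
  rankOf-least {X} {k} bound = max≤v⁺ z≤n (All.map⁺ (All.tabulate λ {I} I∈ → bounded I∈))
    where
    bounded : ∀ {I} → I ∈ˡ filter (λ J → J ⊆? X ×-dec indep? J) (allSubsets n) → ∣ I ∣ ≤ k
    bounded {I} I∈ with ∈-filter⁻ (λ J → J ⊆? X ×-dec indep? J) {xs = allSubsets n} I∈
    ... | _ , I⊆X , ind = bound I⊆X ind

  flat-absorbs : ∀ {X e} → Flat X → rankOf (X ∪ ⁅ e ⁆) ≤ rankOf X → e ∈ X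
  flat-absorbs {X} {e} flat r≤ = subst (e ∈_) flat
    (∈-comprehension⁺ (λ f → rankOf (X ∪ ⁅ f ⁆) ℕ.≟ rankOf X) (≤-antisym r≤
      (rankOf-least λ I⊆X → ∣indep∣≤rankOf (p⊆p∪q ⁅ e ⁆ ∘ I⊆X))))

module Representation (M : Matroid n) (simple : Matroid.Simple M) (D : Digraph v) (T : Subset v)
  (E↣V : Fin n ↣ Fin v)
  (represents : ∀ I → Matroid.Indep M I ⇔ Digraph.LinkableTo D T (image (Injection.to E↣V) I)) where

  open Matroid M
  open Rank M
  open Cuts D T
  open Injection E↣V using () renaming (to to ι; injective to ι-injective)

  cut : Subset v → ℕ
  cut X = ∣ ∂ X ∣

  cut-submodular : ∀ X Y → cut (X ∪ Y) + cut (X ∩ Y) ≤ cut X + cut Y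
  cut-submodular X Y = begin
    cut (X ∪ Y) + cut (X ∩ Y)                    ≡⟨ cong₂ _+_ (─⊥ (X ∪ Y)) (─⊥ (X ∩ Y)) ⟩
    ∣ ∂ (X ∪ Y) ─ ⊥ ∣ + ∣ ∂ (X ∩ Y) ─ ⊥ ∣        ≤⟨ ∂-submodular ⊥ X Y ⟩
    ∣ ∂ X ─ ⊥ ∣ + ∣ ∂ Y ─ ⊥ ∣                    ≡⟨ cong₂ _+_ (─⊥ X) (─⊥ Y) ⟨
    cut X + cut Y                                ∎
    where
    open ≤-Reasoning
    ─⊥ : ∀ W → cut W ≡ ∣ ∂ W ─ ⊥ ∣
    ─⊥ W = cong ∣_∣ (sym (p─⊥≡p (∂ W)))

  open Submodular cut cut-submodular
  open Maximal

  ∣indep∣≤cut : ∀ {I X} → Indep I → image ι I ⊆ X → ∣ I ∣ ≤ cut X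
  ∣indep∣≤cut {I} ind ιI⊆X =
    ≤-trans (∣∣≤∣image∣ ι ι-injective I) (linkable⇒≤cut (Equivalence.to (represents I) ind) ιI⊆X)

  rankOf≤cut : ∀ {Y X} → image ι Y ⊆ X → rankOf Y ≤ cut X
  rankOf≤cut ιY⊆X = rankOf-least λ I⊆Y ind →
    ∣indep∣≤cut ind (image-⊆ ι (ιY⊆X ∘ ∈-image⁺ ι ∘ I⊆Y))

  module _ {I e U} (U-max : Maximal (image ι I) ∣ I ∣ U) (ιe∉U : ι e ∉ U) where

    -- As in `advanced-cut≥`: a set with too few exits would lie in `U` and miss `ι e`.
    ∪-cut≥ : ∀ {X} → image ι (I ∪ ⁅ e ⁆) ⊆ X → ∣ I ∪ ⁅ e ⁆ ∣ ≤ cut X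
    ∪-cut≥ ⊆X = ≤-trans (∣p∪⁅x⁆∣≤1+∣p∣ I e) (≰⇒> λ cut≤ →
      ιe∉U (maximal U-max (image-⊆ ι (⊆X ∘ ∈-image⁺ ι ∘ p⊆p∪q ⁅ e ⁆)) cut≤
        (⊆X (∈-image⁺ ι (q⊆p∪q I ⁅ e ⁆ (x∈⁅x⁆ e))))))

    ∁∪-shrinks : ∣ ∁ (I ∪ ⁅ e ⁆) ∣ < ∣ ∁ I ∣
    ∁∪-shrinks = p⊂q⇒∣p∣<∣q∣ (p⊂q⇒∁p⊃∁q
      ((λ {_} → p⊆p∪q ⁅ e ⁆) , e , q⊆p∪q I ⁅ e ⁆ (x∈⁅x⁆ e) , ιe∉U ∘ contains U-max ∘ ∈-image⁺ ι))

  covers : ∀ Y U → image ι Y ⊆ U ⊎ ∃ λ e → e ∈ Y × ι e ∉ U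
  covers Y U with any? (λ e → e ∈? Y ×-dec ¬? (ι e ∈? U))
  ... | yes e∉ = inj₂ e∉
  ... | no ∄e  = inj₁ (image-⊆ ι λ {e} e∈Y →
    decidable-stable (ι e ∈? U) λ ιe∉U → ∄e (e , e∈Y , ιe∉U))

  -- Grow `I` inside `Y` while every cut around it has at least `∣ I ∣` exits, so that Menger keeps
  -- it independent. The largest tight set around `I` either covers `Y`, and is the cut sought, or
  -- misses an element that can be added.
  cut≤rankOf : ∀ Y → ∃ λ X → image ι Y ⊆ X × cut X ≤ rankOf Y
  cut≤rankOf Y = grow ⊥ (<-wellFounded _) (⊥-elim ∘ ∉⊥) λ {X} _ → subst (_≤ cut X) (sym (∣⊥∣≡0 n)) z≤n
    where
    grow : ∀ I → Acc _<_ ∣ ∁ I ∣ → I ⊆ Y → (∀ {X} → image ι I ⊆ X → ∣ I ∣ ≤ cut X) →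
           ∃ λ X → image ι Y ⊆ X × cut X ≤ rankOf Y
    grow I (acc rec) I⊆Y cut≥ =
      -- The image of `I` itself has at most `∣ I ∣` exits, so the minimum is attained.
      enlarge (maximalSet cut≥ id (≤-trans (p⊆q⇒∣p∣≤∣q∣ ∂⊆) (∣image∣≤ ι I)))
      where
      ind : Indep I
      ind = Equivalence.from (represents I) (≤cut⇒linkable (≤-trans (∣image∣≤ ι I) ∘ cut≥))

      enlarge : ∃ (Maximal (image ι I) ∣ I ∣) → ∃ λ X → image ι Y ⊆ X × cut X ≤ rankOf Y
      enlarge (U , U-max) = [ (λ ιY⊆U → U , ιY⊆U , ≤-trans (value≤ U-max) (∣indep∣≤rankOf I⊆Y ind))
        , (λ (e , e∈Y , ιe∉U) → grow (I ∪ ⁅ e ⁆) (rec (∁∪-shrinks U-max ιe∉U))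
            (∪-lub I⊆Y λ x∈ → subst (_∈ Y) (sym (x∈⁅y⁆⇒x≡y e x∈)) e∈Y) (∪-cut≥ U-max ιe∉U)) ]′
        (covers Y U)

  -- Simplicity enters here and in `2≤cut`: independent sets of size one and two force as many
  -- exits.
  1≤cut : ∀ {e X} → ι e ∈ X → 1 ≤ cut X
  1≤cut {e} {X} ιe∈X = subst (_≤ cut X) (∣⁅x⁆∣≡1 e) (∣indep∣≤cut
    (decidable-stable (indep? ⁅ e ⁆) (proj₁ simple e))
    (image-⊆ ι λ x∈ → subst (λ x → ι x ∈ X) (sym (x∈⁅y⁆⇒x≡y e x∈)) ιe∈X))

  2≤cut : ∀ {e f X} → e ≢ f → ι e ∈ X → ι f ∈ X → 2 ≤ cut X
  2≤cut {e} {f} {X} e≢f ιe∈X ιf∈X = ≤-trans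
    (x≢y⇒2≤∣p∣ (p⊆p∪q ⁅ f ⁆ (x∈⁅x⁆ e)) (q⊆p∪q ⁅ e ⁆ ⁅ f ⁆ (x∈⁅x⁆ f)) e≢f)
    (∣indep∣≤cut
      (decidable-stable (indep? (⁅ e ⁆ ∪ ⁅ f ⁆)) λ dep →
        proj₂ simple e f (e≢f , proj₁ simple e , proj₁ simple f , dep))
      (image-⊆ ι λ x∈ → [ (λ x∈e → subst (λ x → ι x ∈ X) (sym (x∈⁅y⁆⇒x≡y e x∈e)) ιe∈X)
                        , (λ x∈f → subst (λ x → ι x ∈ X) (sym (x∈⁅y⁆⇒x≡y f x∈f)) ιf∈X) ]′
                        (x∈p∪q⁻ ⁅ e ⁆ ⁅ f ⁆ x∈)))

  -- Gates of elements and spans of lines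

  opaque
    pointSet : ∀ e → ∃ (Maximal ⁅ ι e ⁆ 1)
    pointSet e = maximalSet (λ e⊆X → 1≤cut (e⊆X (x∈⁅x⁆ (ι e)))) id
      (≤-trans (p⊆q⇒∣p∣≤∣q∣ ∂⊆) (≤-reflexive (∣⁅x⁆∣≡1 (ι e))))

  C : Fin n → Subset v
  C = proj₁ ∘ pointSet

  C-max : ∀ e → Maximal ⁅ ι e ⁆ 1 (C e)
  C-max = proj₂ ∘ pointSet

  ι∈C : ∀ e → ι e ∈ C e
  ι∈C e = contains (C-max e) (x∈⁅x⁆ (ι e))

  C-largest : ∀ {e X} → ι e ∈ X → cut X ≤ 1 → X ⊆ C e
  C-largest {e} {X} ιe∈X =
    maximal (C-max e) λ x∈ → subst (_∈ X) (sym (x∈⁅y⁆⇒x≡y (ι e) x∈)) ιe∈X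

  opaque
    gateExists : ∀ e → Nonempty (∂ (C e))
    gateExists e = 1≤∣p∣⇒Nonempty (1≤cut (ι∈C e))

  gate : Fin n → Fin v
  gate = proj₁ ∘ gateExists

  gate∈∂C : ∀ e → gate e ∈ ∂ (C e)
  gate∈∂C = proj₂ ∘ gateExists

  ∂C⊆gate : ∀ e {x} → x ∈ ∂ (C e) → x ≡ gate e
  ∂C⊆gate e {x} x∈ = decidable-stable (x ≟ gate e) λ x≢ →
    <⇒≱ (x≢y⇒2≤∣p∣ x∈ (gate∈∂C e) x≢) (value≤ (C-max e))

  -- With a common gate, `C e ∪ C f` would have only that one exit, against `2≤cut`.
  gate-injective : ∀ {e f} → gate e ≡ gate f → e ≡ f
  gate-injective {e} {f} eq = decidable-stable (e ≟ f) λ e≢f →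
    <⇒≱ (2≤cut e≢f (p⊆p∪q (C f) (ι∈C e)) (q⊆p∪q (C e) (C f) (ι∈C f)))
        (≤-trans (p⊆q⇒∣p∣≤∣q∣ ∂∪⊆) (≤-reflexive (∣⁅x⁆∣≡1 (gate e))))
    where
    ∂∪⊆ : ∂ (C e ∪ C f) ⊆ ⁅ gate e ⁆
    ∂∪⊆ {x} x∈ = subst (_∈ ⁅ gate e ⁆) (sym ([ ∂C⊆gate e , (λ x∈f → trans (∂C⊆gate f x∈f) (sym eq)) ]′
      (∂-∪ (C e) (C f) x∈))) (x∈⁅x⁆ (gate e))

  record Spans (L : Subset n) (U : Subset v) : Set where
    field
      long    : LongLine L
      spanSet : Maximal (image ι L) 2 U

  open Spans

  span : ∀ {L} → LongLine L → ∃ (Spans L)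
  span {L} long@(_ , r≡2 , _) =
    let X , ιL⊆X , cut≤ = cut≤rankOf L
        U , U-max       = maximalSet (λ ιL⊆ → ≤-trans (≤-reflexive (sym r≡2)) (rankOf≤cut ιL⊆))
                                     ιL⊆X (≤-trans cut≤ (≤-reflexive r≡2))
    in U , record { long = long ; spanSet = U-max }

  module _ {L U} (s : Spans L U) where

    -- Since `U` has at most two exits, adding `e` to `L` does not raise the rank, and `L` is a
    -- flat.
    ι∈span⇒∈ : ∀ {e} → ι e ∈ U → e ∈ L
    ι∈span⇒∈ {e} ιe∈U = flat-absorbs (proj₁ (long s)) (≤-trans (rankOf≤cut ⊆U)
      (≤-trans (value≤ (spanSet s)) (≤-reflexive (sym (proj₁ (proj₂ (long s)))))))
      where
      ⊆U : image ι (L ∪ ⁅ e ⁆) ⊆ U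
      ⊆U = image-⊆ ι λ x∈ → [ contains (spanSet s) ∘ ∈-image⁺ ι
                            , (λ x∈e → subst (λ x → ι x ∈ U) (sym (x∈⁅y⁆⇒x≡y e x∈e)) ιe∈U) ]′
                            (x∈p∪q⁻ L ⁅ e ⁆ x∈)

    cut≤2⇒⊆span : ∀ {X} → cut (U ∪ X) ≤ 2 → X ⊆ U
    cut≤2⇒⊆span {X} cut≤ = maximal (spanSet s) (p⊆p∪q X ∘ contains (spanSet s)) cut≤ ∘ q⊆p∪q U X

    -- `U` and `C e` share `ι e`, so their intersection has an exit and their union has at most 2 +
    -- 1 - 1.
    gate∈span : ∀ {e} → e ∈ L → gate e ∈ U
    gate∈span {e} e∈L = cut≤2⇒⊆span (+-cancelʳ-≤ 1 (cut (U ∪ C e)) 2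
      (∪-tight (value≤ (spanSet s)) (value≤ (C-max e))
        (1≤cut (x∈p∩q⁺ (contains (spanSet s) (∈-image⁺ ι e∈L) , ι∈C e)))))
      (∂⊆ (gate∈∂C e))

    -- Once the only exit of `C e` lies in `U`, adding `C e` to `U` creates no new exit.
    gate∈span⇒C⊆ : ∀ {e} → gate e ∈ U → C e ⊆ U
    gate∈span⇒C⊆ {e} g∈U = cut≤2⇒⊆span (≤-trans
      (p⊆q⇒∣p∣≤∣q∣ λ {x} x∈ → [ id , retract x∈ ]′ (∂-∪ U (C e) x∈))
      (value≤ (spanSet s)))
      where
      retract : ∀ {x} → x ∈ ∂ (U ∪ C e) → x ∈ ∂ (C e) → x ∈ ∂ U
      retract x∈ x∈∂C = ∂-restrict (p⊆p∪q (C e)) (subst (_∈ U) (sym (∂C⊆gate e x∈∂C)) g∈U) x∈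

  -- A union with at most two exits would be absorbed by both spans, and a span contains no element
  -- outside its line.
  spans-cut≥3 : ∀ {L L′ U U′} → Spans L U → Spans L′ U′ → L ≢ L′ → 3 ≤ cut (U ∪ U′)
  spans-cut≥3 {U = U} {U′} s s′ L≢L′ = ≰⇒> λ cut≤ → L≢L′ (⊆-antisym
    (λ e∈L → ι∈span⇒∈ s′ (cut≤2⇒⊆span s′ (subst (λ X → cut X ≤ 2) (∪-comm U U′) cut≤)
               (contains (spanSet s) (∈-image⁺ ι e∈L))))
    (λ e∈L′ → ι∈span⇒∈ s (cut≤2⇒⊆span s cut≤ (contains (spanSet s′) (∈-image⁺ ι e∈L′)))))

  -- The spans of two distinct lines meet in a set of cut at most 1, hence inside C e
  -- as soon as they share gate e, and there gate e remains an exit.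
  gate-interior-once : ∀ {L L′ U U′ e} → Spans L U → Spans L′ U′ → L ≢ L′ →
                       gate e ∈ U ─ ∂ U → gate e ∉ U′ ─ ∂ U′
  gate-interior-once {U = U} {U′} {e} s s′ L≢L′ g∈ g∈′ =
    [ x∈p─q⇒x∉q U (∂ U) g∈ , x∈p─q⇒x∉q U′ (∂ U′) g∈′ ]′
      (∂-∩ U U′ (∂-restrict U∩U′⊆C (x∈p∩q⁺ (g∈U , g∈U′)) (gate∈∂C e)))
    where
    g∈U : gate e ∈ U
    g∈U = p─q⊆p U (∂ U) g∈

    g∈U′ : gate e ∈ U′
    g∈U′ = p─q⊆p U′ (∂ U′) g∈′

    cut∩≤1 : cut (U ∩ U′) ≤ 1
    -- The spans have at most 2 + 2 exits together, and the union accounts for at least 3.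
    cut∩≤1 = +-cancelˡ-≤ 3 (cut (U ∩ U′)) 1 (≤-trans (+-monoˡ-≤ _ (spans-cut≥3 s s′ L≢L′))
      (≤-trans (cut-submodular U U′) (+-mono-≤ (value≤ (spanSet s)) (value≤ (spanSet s′)))))

    U∩U′⊆C : U ∩ U′ ⊆ C e
    U∩U′⊆C = C-largest (x∈p∩q⁺ (gate∈span⇒C⊆ s g∈U (ι∈C e) , gate∈span⇒C⊆ s′ g∈U′ (ι∈C e))) cut∩≤1

  -- Adding the spans one by one

  gates : Subset v
  gates = image gate ⊤

  excess : List (Subset n) → ℕ
  excess Ls = sum (map (λ L → ∣ L ∣ ∸ 2) Ls)

  -- F may exceed ∂ X: a gate stays in F until it is a non-exit of the span of a single
  -- line, even if it stops being an exit of X earlier.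
  record Frontier (Ls : List (Subset n)) : Set where
    field
      X F       : Subset v
      ι∈X       : ∀ e → ι e ∈ X
      gate∈X    : ∀ e → gate e ∈ X
      ∂X⊆F      : ∂ X ⊆ F
      size      : excess Ls + ∣ F ∣ ≤ n
      gateState : ∀ e → gate e ∈ F ⊎ (∃ λ L → L ∈ˡ Ls × ∃ λ U → Spans L U × gate e ∈ U ─ ∂ U)

  initial : Frontier []
  initial = record
    { X         = X
    ; F         = gates
    ; ι∈X       = λ e → C⊆X (ι∈C e)
    ; gate∈X    = λ e → C⊆X (∂⊆ (gate∈∂C e))
    ; ∂X⊆F      = ∂X⊆gates
    ; size      = ≤-trans (∣image∣≤ gate ⊤) (∣p∣≤n (⊤ {n}))
    ; gateState = λ e → inj₁ (∈-image⁺ gate ∈⊤)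
    }
    where
    inSomeC? : Decidable λ x → ∃ λ e → x ∈ C e
    inSomeC? x = any? λ e → x ∈? C e

    X : Subset v
    X = comprehension inSomeC?

    C⊆X : ∀ {e} → C e ⊆ X
    C⊆X {e} x∈ = ∈-comprehension⁺ inSomeC? (e , x∈)

    ∂X⊆gates : ∂ X ⊆ gates
    ∂X⊆gates x∈ with ∈-comprehension⁻ inSomeC? (∂⊆ x∈)
    ... | e , x∈C = subst (_∈ gates) (sym (∂C⊆gate e (∂-restrict C⊆X x∈C x∈))) (∈-image⁺ gate ∈⊤)

  extendFrontier : ∀ {L Ls} → All (L ≢_) Ls → ∃ (Spans L) → Frontier Ls → Frontier (L ∷ Ls)
  extendFrontier {L} {Ls} L∉Ls (U , s) fr = record
    { X         = X ∪ U
    ; F         = F′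
    ; ι∈X       = p⊆p∪q U ∘ ι∈X
    ; gate∈X    = p⊆p∪q U ∘ gate∈X
    ; ∂X⊆F      = ∂⊆F′
    ; size      = size′
    ; gateState = gateState′
    }
    where
    open Frontier fr

    I F′ : Subset v
    I  = U ─ ∂ U
    -- Exits of `U` that are gates need not be added: every gate lies in `X`, so an exit outside `X`
    -- is not a gate.
    F′ = (F ─ I) ∪ (∂ U ─ gates)

    ∂⊆F′ : ∂ (X ∪ U) ⊆ F′
    ∂⊆F′ {x} x∈ with x ∈? X
    ... | yes x∈X = p⊆p∪q _ (x∈p∧x∉q⇒x∈p─q (∂X⊆F (∂-restrict (p⊆p∪q U) x∈X x∈))
      λ x∈I → x∈p─q⇒x∉q U (∂ U) x∈I (∂-restrict (q⊆p∪q X U) (p─q⊆p U (∂ U) x∈I) x∈))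
    ... | no x∉X = q⊆p∪q (F ─ I) _ (x∈p∧x∉q⇒x∈p─q
      ([ (λ x∈∂X → ⊥-elim (x∉X (∂⊆ x∈∂X))) , id ]′ (∂-∪ X U x∈))
      λ x∈gates → let e , _ , ge≡x = ∈-image⁻ gate x∈gates in x∉X (subst (_∈ X) ge≡x (gate∈X e)))

    -- A gate missing from `F` is interior to the span of an earlier line, and no gate is interior
    -- to two spans.
    gate∈I⇒F : ∀ {e} → gate e ∈ I → gate e ∈ F
    gate∈I⇒F {e} g∈I with gateState e
    ... | inj₁ g∈F = g∈F
    ... | inj₂ (L′ , L′∈ , U′ , s′ , g∈I′) =
      ⊥-elim (gate-interior-once s s′ (All.lookup L∉Ls L′∈) g∈I g∈I′)

    gateState′ : ∀ e → gate e ∈ F′ ⊎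
                 (∃ λ L′ → L′ ∈ˡ L ∷ Ls × ∃ λ U′ → Spans L′ U′ × gate e ∈ U′ ─ ∂ U′)
    gateState′ e with gate e ∈? I | gateState e
    ... | yes g∈I | _        = inj₂ (L , here refl , U , s , g∈I)
    ... | no  g∉I | inj₁ g∈F = inj₁ (p⊆p∪q _ (x∈p∧x∉q⇒x∈p─q g∈F g∉I))
    ... | no  _   | inj₂ (L′ , L′∈ , rest) = inj₂ (L′ , there L′∈ , rest)

    -- The gates of `L` lie in `U`: the interior ones are removed from `F`, the others are exits of
    -- `U` that add nothing to `F′`.
    ∣L∣≤ : ∣ L ∣ ≤ ∣ F ∩ I ∣ + ∣ ∂ U ∩ gates ∣
    ∣L∣≤ = ≤-trans (injection⇒∣p∣≤∣q∣ (λ {e} _ → gate e) place λ _ _ → gate-injective)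
                   (∣p∪q∣≤∣p∣+∣q∣ (F ∩ I) (∂ U ∩ gates))
      where
      place : ∀ {e} → e ∈ L → gate e ∈ (F ∩ I) ∪ (∂ U ∩ gates)
      place {e} e∈L with gate e ∈? ∂ U
      ... | yes g∈∂U = q⊆p∪q (F ∩ I) _ (x∈p∩q⁺ (g∈∂U , ∈-image⁺ gate ∈⊤))
      ... | no  g∉∂U = p⊆p∪q _ (x∈p∩q⁺ (gate∈I⇒F g∈I , g∈I))
        where
        g∈I : gate e ∈ I
        g∈I = x∈p∧x∉q⇒x∈p─q (gate∈span s e∈L) g∉∂U

    -- The four pieces reassemble to `F` and `∂ U`; the 2 bounds the exits of a span.
    ∣L∣+∣F′∣≤ : ∣ L ∣ + ∣ F′ ∣ ≤ ∣ F ∣ + 2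
    ∣L∣+∣F′∣≤ = begin
      ∣ L ∣ + ∣ F′ ∣
        ≤⟨ +-mono-≤ ∣L∣≤ (∣p∪q∣≤∣p∣+∣q∣ (F ─ I) (∂ U ─ gates)) ⟩
      (∣ F ∩ I ∣ + ∣ ∂ U ∩ gates ∣) + (∣ F ─ I ∣ + ∣ ∂ U ─ gates ∣)
        ≡⟨ interchange (∣ F ∩ I ∣) (∣ ∂ U ∩ gates ∣) (∣ F ─ I ∣) (∣ ∂ U ─ gates ∣) ⟩
      (∣ F ∩ I ∣ + ∣ F ─ I ∣) + (∣ ∂ U ∩ gates ∣ + ∣ ∂ U ─ gates ∣)
        ≡⟨ cong₂ _+_ (∣p∣≡∣p∩q∣+∣p─q∣ F I) (∣p∣≡∣p∩q∣+∣p─q∣ (∂ U) gates) ⟨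
      ∣ F ∣ + cut U
        ≤⟨ +-monoʳ-≤ ∣ F ∣ (value≤ (spanSet s)) ⟩
      ∣ F ∣ + 2 ∎
      where open ≤-Reasoning

    size′ : excess (L ∷ Ls) + ∣ F′ ∣ ≤ n
    size′ = begin
      (∣ L ∣ ∸ 2) + excess Ls + ∣ F′ ∣      ≡⟨ cong (_+ ∣ F′ ∣) (+-comm (∣ L ∣ ∸ 2) (excess Ls)) ⟩
      excess Ls + (∣ L ∣ ∸ 2) + ∣ F′ ∣      ≡⟨ +-assoc (excess Ls) (∣ L ∣ ∸ 2) ∣ F′ ∣ ⟩
      excess Ls + ((∣ L ∣ ∸ 2) + ∣ F′ ∣)    ≡⟨ cong (excess Ls +_) (+-comm (∣ L ∣ ∸ 2) ∣ F′ ∣) ⟩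
      -- Truncated subtraction moves past `∣ F′ ∣` because a long line has at least two elements.
      excess Ls + (∣ F′ ∣ + (∣ L ∣ ∸ 2))    ≡⟨ cong (excess Ls +_) (+-∸-assoc ∣ F′ ∣ 2≤∣L∣) ⟨
      excess Ls + ((∣ F′ ∣ + ∣ L ∣) ∸ 2)    ≡⟨ cong (λ k → excess Ls + (k ∸ 2)) (+-comm ∣ F′ ∣ ∣ L ∣) ⟩
      excess Ls + ((∣ L ∣ + ∣ F′ ∣) ∸ 2)    ≤⟨ +-monoʳ-≤ (excess Ls) (∸-monoˡ-≤ 2 ∣L∣+∣F′∣≤) ⟩
      excess Ls + ((∣ F ∣ + 2) ∸ 2)         ≡⟨ cong (excess Ls +_) (m+n∸n≡m ∣ F ∣ 2) ⟩
      excess Ls + ∣ F ∣                     ≤⟨ size ⟩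
      n                                     ∎
      where
      open ≤-Reasoning
      2≤∣L∣ : 2 ≤ ∣ L ∣
      2≤∣L∣ = ≤-trans (n≤1+n 2) (proj₂ (proj₂ (long s)))

  frontier : ∀ {Ls} → Unique Ls → All LongLine Ls → Frontier Ls
  frontier []              []             = initial
  frontier (L∉Ls ∷ unique) (long ∷ longs) = extendFrontier L∉Ls (span long) (frontier unique longs)

  -- The final `X` contains every element, so its exits, and with them `F`, number at least the
  -- rank.
  excess+rank≤n : excess longLines + rank ≤ n
  excess+rank≤n = ≤-trans
    (+-monoʳ-≤ (excess longLines) (≤-trans (rankOf≤cut ιE⊆X) (p⊆q⇒∣p∣≤∣q∣ ∂X⊆F))) size
    where
    open Frontier (frontier (Unique.filter⁺ longLine? (allSubsets-unique n))
                            (All.all-filter longLine? (allSubsets n)))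

    ιE⊆X : image ι ⊤ ⊆ X
    ιE⊆X = image-⊆ ι λ {e} _ → ι∈X e

proposition1p3 : ∀ {n : ℕ} (M : Matroid n) → IsGammoid M → Matroid.Simple M →
    sum (map (λ L → ∣ L ∣ ∸ 2) (Matroid.longLines M)) ≤ n ∸ Matroid.rank M
proposition1p3 {n} M (v , D , T , E↣V , represents) simple =
  -- Subtracting the rank from both sides of the additive bound is exact on the left, where it
  -- cancels a summand.
  subst (_≤ n ∸ Matroid.rank M) (m+n∸n≡m _ (Matroid.rank M)) (∸-monoˡ-≤ (Matroid.rank M) excess+rank≤n)
  where open Representation M simple D T E↣V represents
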